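{- Let $\mathcal{A}$ be a downset in $\mathcal{B}(n)$, and let $\mathcal{I}$ be the set of the first $|\mathcal{A}|$ elements of the level-colex order on $\mathcal{B}(n)$. Then $m(\mathcal{A}) \le m(\mathcal{I})$.
   Context: $\mathcal{B}(n)$ is the Boolean lattice of all subsets of $[n]=\{1,\dots,n\}$ ordered by inclusion. A downset is a family $\mathcal{D}$ such that $X \in \mathcal{D}$ and $Y \subseteq X$ imply $Y \in \mathcal{D}$. For a downset $\mathcal{D}$, $m(\mathcal{D})$ denotes the number of inclusion-maximal elements of $\mathcal{D}$. The level-colex order on $\mathcal{B}(n)$ is the total order with $A<B$ if either $|A|<|B|$, or $|A|=|B|$ and $\max(A \triangle B) \in B$. -}

module Defs where

open import Data.Nat using (ℕ; zero; suc; _<ᵇ_; _≡ᵇ_)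
open import Data.Bool using (Bool; true; false; _∧_; _∨_; not; if_then_else_)
open import Data.Maybe using (Maybe; just; nothing)
open import Data.List using (List; []; _∷_; _++_; map)
open import Data.Bool.ListAction using (any)
open import Data.Vec using (Vec; []; _∷_)
open import Data.Fin.Subset using (Subset; _⊆_; _⊂_; ∣_∣)
open import Data.Fin.Subset.Properties using (_⊂?_)
open import Relation.Nullary using (does)
open import Relation.Binary.PropositionalEquality using (_≡_)

-- Subsets of [n] are bit-vectors 'Subset n'; position i : Fin n stands for
-- the element i+1 of [n], so the order on [n] is the order on Fin n
-- (the last position of the vector is the largest element n).

allSubsets : (n : ℕ) → List (Subset n)
allSubsets zero    = [] ∷ []
allSubsets (suc n) = map (false ∷_) (allSubsets n) ++ map (true ∷_) (allSubsets n)

countᵇ : {A : Set} → (A → Bool) → List A → ℕ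
countᵇ p []       = zero
countᵇ p (x ∷ xs) = if p x then suc (countᵇ p xs) else countᵇ p xs

Family : ℕ → Set
Family n = Subset n → Bool

size : {n : ℕ} → Family n → ℕ
size {n} 𝒜 = countᵇ (λ X → 𝒜 X) (allSubsets n)

IsDownset : {n : ℕ} → Family n → Set
IsDownset {n} 𝒟 = (X Y : Subset n) → Y ⊆ X → 𝒟 X ≡ true → 𝒟 Y ≡ true

isMaximal : {n : ℕ} → Family n → Subset n → Bool
isMaximal {n} 𝒟 X = 𝒟 X ∧ not (any (λ Y → 𝒟 Y ∧ does (X ⊂? Y)) (allSubsets n))

m : {n : ℕ} → Family n → ℕ
m {n} 𝒟 = countᵇ (λ X → isMaximal 𝒟 X) (allSubsets n)

-- The value of B at max(A △ B) (nothing if A = B).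
-- The head of the vector is element 1, so the largest differing element is
-- found by looking at the tail first.
topDiffInB : {n : ℕ} → Subset n → Subset n → Maybe Bool
topDiffInB []       []       = nothing
topDiffInB (a ∷ as) (b ∷ bs) with topDiffInB as bs
... | just v  = just v
... | nothing = if (a ∧ not b) ∨ (not a ∧ b) then just b else nothing

_<lc_ : {n : ℕ} → Subset n → Subset n → Bool
A <lc B with ∣ A ∣ <ᵇ ∣ B ∣ | ∣ A ∣ ≡ᵇ ∣ B ∣ | topDiffInB A B
... | true  | _    | _        = true
... | false | true | just v   = v
... | false | true | nothing  = false
... | false | false | _       = false

lcRank : {n : ℕ} → Subset n → ℕ
lcRank {n} B = countᵇ (λ C → C <lc B) (allSubsets n)

initialSegment : (n k : ℕ) → Family n
initialSegment n k B = lcRank B <ᵇ k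

{-# OPTIONS --safe #-}
module Submission where

-- For a downset D, m D is the cardinality of D minus that of its shadow
-- {X : X covered by a member of D}, so it suffices that, among all families F of a given size
-- (downsets or not), an initial segment of level-colex has the smallest shadow.  This goes by
-- induction on n with Harper-style compressions: splitting F along a coordinate i and replacing both
-- sections by initial segments does not enlarge the shadow, because shadows of initial segments are
-- initial segments and any two of those are nested.  If A < B with A ∉ F, B ∈ F and A, B agree at i,
-- this compression strictly lowers a sum of order-preserving numerical keys over F.  Once no such pair
-- is left, every inversion (A , B) consists of complementary sets; then there is at most one, and
-- replacing B by A gives an initial segment whose shadow is contained in that of F.

open import Defs
open import Algebra.Properties.CommutativeSemigroup using (interchange)
open import Data.Bool using (Bool; true; false; T; _∧_; _∨_; not)
open import Data.Bool.ListAction using (any)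
import Data.Bool.Properties as Bool
open import Data.Fin using (Fin; zero; suc)
open import Data.Fin.Properties using (any?)
open import Data.Fin.Subset using (Subset; _⊆_; _⊂_; ∣_∣; ∁)
open import Data.Fin.Subset.Properties
  using (anySubset?; ∣p∣≤n; p⊆q⇒∣p∣≤∣q∣; drop-∷-⊆; drop-∷-⊂; in⊆in; out⊂in; s⊆s; s⊂s; ⊆-refl; _⊂?_)
open import Data.List using (List; []; _∷_; _++_; map)
open import Data.List.Membership.Propositional using (_∈_; lose; find)
open import Data.List.Membership.Propositional.Properties using (∈-++⁺ˡ; ∈-++⁺ʳ; ∈-map⁺)
open import Data.List.Relation.Unary.Any using (here)
open import Data.List.Relation.Unary.Any.Properties using (any⁺; any⁻)
open import Data.Maybe using (Maybe; just; nothing)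
open import Data.Nat hiding (_≟_)
open import Data.Nat.Properties
open import Data.Product using (∃; _×_; _,_; proj₁; proj₂)
open import Data.Sum using (_⊎_; inj₁; inj₂)
open import Data.Vec using ([]; _∷_; here; insertAt; removeAt; lookup)
open import Data.Vec.Properties using (≡-dec; insertAt-lookup; removeAt-insertAt; insertAt-removeAt)
open import Function using (Equivalence)
open import Relation.Binary using (tri<; tri≈; tri>)
open import Relation.Binary.PropositionalEquality
open import Relation.Nullary using (¬_; Dec; yes; no; does; proof; contradiction; Reflects; ofʸ; ofⁿ; invert)
open import Relation.Nullary.Decidable using (_×-dec_; toSum; dec-true)

private variable
  n : ℕ

-- The level-colex order as an order on numbers

bit : Bool → ℕ
bit false = 0
bit true  = 1

bit-injective : ∀ {a b} → bit a ≡ bit b → a ≡ b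
bit-injective {false} {false} _ = refl
bit-injective {true}  {true}  _ = refl

bit<2 : ∀ b → bit b < 2
bit<2 false = s≤s z≤n
bit<2 true  = s≤s (s≤s z≤n)

digit-< : ∀ a b {x y} → x < y → bit a + 2 * x < bit b + 2 * y
digit-< a b {x} {y} x<y = begin-strict
  bit a + 2 * x  <⟨ +-monoˡ-< (2 * x) (bit<2 a) ⟩
  2 + 2 * x      ≡⟨ *-suc 2 x ⟨
  2 * suc x      ≤⟨ *-monoʳ-≤ 2 x<y ⟩
  2 * y          ≤⟨ m≤n+m (2 * y) (bit b) ⟩
  bit b + 2 * y  ∎
  where open ≤-Reasoning

digit-<⁻ : ∀ a b x y → bit a + 2 * x < bit b + 2 * y → x < y ⊎ (x ≡ y × a ≡ false × b ≡ true)
digit-<⁻ a b x y lt with <-cmp x y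
... | tri< x<y _ _ = inj₁ x<y
... | tri> _ _ y<x = contradiction lt (<-asym (digit-< b a y<x))
digit-<⁻ false true  x x lt | tri≈ _ refl _ = inj₂ (refl , refl , refl)
digit-<⁻ false false x x lt | tri≈ _ refl _ = contradiction lt (<-irrefl refl)
digit-<⁻ true  true  x x lt | tri≈ _ refl _ = contradiction lt (<-irrefl refl)
digit-<⁻ true  false x x lt | tri≈ _ refl _ = contradiction lt (<-asym (n<1+n (2 * x)))

-- The head is the least significant binary digit, so comparing values decides at the largest
-- differing element, as colex does.
val : Subset n → ℕ
val []      = 0
val (b ∷ X) = bit b + 2 * val X

val-injective : (X Y : Subset n) → val X ≡ val Y → X ≡ Y
val-injective []      []      _  = refl
val-injective (a ∷ X) (b ∷ Y) eq with <-cmp (val X) (val Y)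
... | tri< lt _ _ = contradiction eq (<⇒≢ (digit-< a b lt))
... | tri> _ _ gt = contradiction (sym eq) (<⇒≢ (digit-< b a gt))
... | tri≈ _ vX≡vY _ with val-injective X Y vX≡vY
... | refl = cong (_∷ X) (bit-injective (+-cancelʳ-≡ (2 * val X) (bit a) (bit b) eq))

val<2^n : (X : Subset n) → val X < 2 ^ n
val<2^n []      = s≤s z≤n
val<2^n (b ∷ X) = digit-< b false (val<2^n X)

val-∷-<⁻ : ∀ a b (X Y : Subset n) → val (a ∷ X) < val (b ∷ Y) →
           val X < val Y ⊎ (X ≡ Y × a ≡ false × b ≡ true)
val-∷-<⁻ a b X Y lt with digit-<⁻ a b (val X) (val Y) lt
... | inj₁ vX<vY            = inj₁ vX<vY
... | inj₂ (vX≡vY , a0 , b1) = inj₂ (val-injective X Y vX≡vY , a0 , b1)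

-- val X < 2 ^ n, so comparing keys compares cardinalities first and then colexicographically.
key : Subset n → ℕ
key {n} X = ∣ X ∣ * 2 ^ n + val X

∣∣-<⇒key-< : (X Y : Subset n) → ∣ X ∣ < ∣ Y ∣ → key X < key Y
∣∣-<⇒key-< {n} X Y lt = begin-strict
  ∣ X ∣ * 2 ^ n + val X  <⟨ +-monoʳ-< (∣ X ∣ * 2 ^ n) (val<2^n X) ⟩
  ∣ X ∣ * 2 ^ n + 2 ^ n  ≡⟨ +-comm (∣ X ∣ * 2 ^ n) (2 ^ n) ⟩
  suc ∣ X ∣ * 2 ^ n      ≤⟨ *-monoˡ-≤ (2 ^ n) lt ⟩
  ∣ Y ∣ * 2 ^ n          ≤⟨ m≤m+n _ (val Y) ⟩
  ∣ Y ∣ * 2 ^ n + val Y  ∎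
  where open ≤-Reasoning

val-<⇒key-< : (X Y : Subset n) → ∣ X ∣ ≤ ∣ Y ∣ → val X < val Y → key X < key Y
val-<⇒key-< {n} X Y le lt = +-mono-≤-< (*-monoˡ-≤ (2 ^ n) le) lt

key-<⁻ : (X Y : Subset n) → key X < key Y → ∣ X ∣ < ∣ Y ∣ ⊎ (∣ X ∣ ≡ ∣ Y ∣ × val X < val Y)
key-<⁻ {n} X Y lt with <-cmp ∣ X ∣ ∣ Y ∣
... | tri< p _ _ = inj₁ p
... | tri> _ _ p = contradiction lt (<-asym (∣∣-<⇒key-< Y X p))
... | tri≈ _ p _ = inj₂ (p , +-cancelˡ-< (∣ Y ∣ * 2 ^ n) (val X) (val Y)
                            (subst (λ k → k * 2 ^ n + val X < key Y) p lt))

key-injective : (X Y : Subset n) → key X ≡ key Y → X ≡ Y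
key-injective {n} X Y eq with <-cmp ∣ X ∣ ∣ Y ∣
... | tri< p _ _ = contradiction eq (<⇒≢ (∣∣-<⇒key-< X Y p))
... | tri> _ _ p = contradiction (sym eq) (<⇒≢ (∣∣-<⇒key-< Y X p))
... | tri≈ _ p _ = val-injective X Y (+-cancelˡ-≡ (∣ Y ∣ * 2 ^ n) (val X) (val Y)
                     (subst (λ k → k * 2 ^ n + val X ≡ key Y) p eq))

key-<⇒∣∣-≤ : (X Y : Subset n) → key X < key Y → ∣ X ∣ ≤ ∣ Y ∣
key-<⇒∣∣-≤ X Y lt with key-<⁻ X Y lt
... | inj₁ p       = <⇒≤ p
... | inj₂ (p , _) = ≤-reflexive p

∣insertAt∣ : ∀ (X : Subset n) i b → ∣ insertAt X i b ∣ ≡ bit b + ∣ X ∣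
∣insertAt∣ X zero    false = refl
∣insertAt∣ X zero    true  = refl
∣insertAt∣ (false ∷ X) (suc i) b = ∣insertAt∣ X i b
∣insertAt∣ (true  ∷ X) (suc i) b = trans (cong suc (∣insertAt∣ X i b)) (sym (+-suc (bit b) ∣ X ∣))

val-insertAt-< : ∀ (X Y : Subset n) i b → val X < val Y → val (insertAt X i b) < val (insertAt Y i b)
val-insertAt-< X Y zero b lt = +-monoʳ-< (bit b) (*-monoʳ-< 2 lt)
val-insertAt-< (x ∷ X) (y ∷ Y) (suc i) b lt with val-∷-<⁻ x y X Y lt
... | inj₁ p                    = digit-< x y (val-insertAt-< X Y i b p)
... | inj₂ (refl , refl , refl) = ≤-refl

-- A digit common to both sets changes neither the comparison of cardinalities nor the largest
-- difference. Hence level-colex on the sets with a fixed value at `i` is level-colex on the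
-- remaining coordinates.
key-insertAt-< : ∀ (X Y : Subset n) i b → key X < key Y → key (insertAt X i b) < key (insertAt Y i b)
key-insertAt-< X Y i b lt with key-<⁻ X Y lt
... | inj₁ p = ∣∣-<⇒key-< (insertAt X i b) (insertAt Y i b)
                 (subst₂ _<_ (sym (∣insertAt∣ X i b)) (sym (∣insertAt∣ Y i b)) (+-monoʳ-< (bit b) p))
... | inj₂ (p , q) = val-<⇒key-< (insertAt X i b) (insertAt Y i b)
                 (≤-reflexive (trans (∣insertAt∣ X i b) (trans (cong (bit b +_) p) (sym (∣insertAt∣ Y i b)))))
                 (val-insertAt-< X Y i b q)

-- Covers in the Boolean lattice

infix 4 _⋖_

data _⋖_ : Subset n → Subset n → Set where
  here  : {C : Subset n} → (false ∷ C) ⋖ (true ∷ C)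
  there : ∀ {b} {C X : Subset n} → C ⋖ X → (b ∷ C) ⋖ (b ∷ X)

⋖⇒∣∣ : {C X : Subset n} → C ⋖ X → ∣ X ∣ ≡ suc ∣ C ∣
⋖⇒∣∣ here = refl
⋖⇒∣∣ (there {b = false} r) = ⋖⇒∣∣ r
⋖⇒∣∣ (there {b = true}  r) = cong suc (⋖⇒∣∣ r)

⋖⇒val-< : {C X : Subset n} → C ⋖ X → val C < val X
⋖⇒val-< here = ≤-refl
⋖⇒val-< (there {b = b} r) = digit-< b b (⋖⇒val-< r)

∃⋗ : (C : Subset n) → ∣ C ∣ < n → ∃ λ X → C ⋖ X
∃⋗ (false ∷ C) _ = true ∷ C , here
∃⋗ (true  ∷ C) (s≤s lt) with ∃⋗ C lt
... | X , r = true ∷ X , there r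

∃⋖ : (X : Subset n) → 0 < ∣ X ∣ → ∃ λ C → C ⋖ X
∃⋖ (true  ∷ X) _ = false ∷ X , here
∃⋖ (false ∷ X) lt with ∃⋖ X lt
... | C , r = false ∷ C , there r

-- The two elements that lead from `C` to `D` can be added in either order; `Z` comes from the order
-- that avoids `A`.
⋖-diamond : {C A D : Subset n} → C ⋖ A → A ⋖ D → ∃ λ Z → C ⋖ Z × Z ⋖ D × Z ≢ A
⋖-diamond here      (there r) = _ , there r , here , λ ()
⋖-diamond (there r) here      = _ , here , there r , λ ()
⋖-diamond (there r) (there s) with ⋖-diamond r s
... | Z , p , q , ne = _ , there p , there q , λ { refl → ne refl }

∣∣≡0-unique : (X Y : Subset n) → ∣ X ∣ ≡ 0 → ∣ Y ∣ ≡ 0 → X ≡ Y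
∣∣≡0-unique []          []          _ _ = refl
∣∣≡0-unique (false ∷ X) (false ∷ Y) p q = cong (false ∷_) (∣∣≡0-unique X Y p q)

-- The witness Y is D ∪ {min of the complement of D}, the smallest cover of D in colex order.
val-<⇒∃⋗ : (D C : Subset n) → ∣ D ∣ < ∣ C ∣ → val D < val C → ∃ λ Y → D ⋖ Y × val Y ≤ val C
val-<⇒∃⋗ (false ∷ D) (c ∷ C) lt vlt with val-∷-<⁻ false c D C vlt
... | inj₁ p = true ∷ D , here , <⇒≤ (digit-< true c p)
... | inj₂ (refl , _ , refl) = true ∷ D , here , ≤-refl
val-<⇒∃⋗ (true ∷ D) (c ∷ C) lt vlt with val-∷-<⁻ true c D C vlt
val-<⇒∃⋗ (true ∷ D) (true ∷ C) (s≤s lt) vlt | inj₁ p with val-<⇒∃⋗ D C lt p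
... | Y , r , le = true ∷ Y , there r , +-monoʳ-≤ 1 (*-monoʳ-≤ 2 le)
val-<⇒∃⋗ (true ∷ D) (false ∷ C) lt vlt | inj₁ p with val-<⇒∃⋗ D C (<⇒≤ lt) p
-- The heads now compare the wrong way, so the tails must differ strictly: `Y` has fewer elements
-- than `C`.
... | Y , r , le = true ∷ Y , there r , <⇒≤ (digit-< true false (≤∧≢⇒< le vY≢vC))
  where
  vY≢vC : val Y ≢ val C
  vY≢vC eq = <⇒≢ lt (trans (sym (⋖⇒∣∣ r)) (cong ∣_∣ (val-injective Y C eq)))

-- Adding the least missing element is monotone in colex within a level. If the heads are `true` and
-- `false`, the tail of `D` has one element fewer than that of `C`, and `val-<⇒∃⋗` applies.
val-<⇒∃⋗-≤ : (D C X : Subset n) → ∣ D ∣ ≡ ∣ C ∣ → val D < val C → C ⋖ X → ∃ λ Y → D ⋖ Y × val Y ≤ val X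
val-<⇒∃⋗-≤ (d ∷ D) (c ∷ C) X eq vlt r with val-∷-<⁻ d c D C vlt
val-<⇒∃⋗-≤ (false ∷ D) (true ∷ D) X eq vlt r | inj₂ (refl , refl , refl) = contradiction eq (<⇒≢ ≤-refl)
val-<⇒∃⋗-≤ (false ∷ D) (c ∷ C) X eq vlt r | inj₁ p =
  true ∷ D , here , <⇒≤ (<-trans (digit-< true c p) (⋖⇒val-< r))
val-<⇒∃⋗-≤ (true ∷ D) (true ∷ C) (true ∷ X) eq vlt (there r) | inj₁ p
  with val-<⇒∃⋗-≤ D C X (suc-injective eq) p r
... | Y , s , le = true ∷ Y , there s , +-monoʳ-≤ 1 (*-monoʳ-≤ 2 le)
val-<⇒∃⋗-≤ (true ∷ D) (false ∷ C) (true ∷ C) eq vlt here | inj₁ p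
  with val-<⇒∃⋗ D C (≤-reflexive eq) p
... | Y , s , le = true ∷ Y , there s , +-monoʳ-≤ 1 (*-monoʳ-≤ 2 le)
val-<⇒∃⋗-≤ (true ∷ D) (false ∷ C) (false ∷ X) eq vlt (there r) | inj₁ p
  with val-<⇒∃⋗ D C (≤-reflexive eq) p
... | Y , s , le = true ∷ Y , there s , <⇒≤ (digit-< true false (≤-<-trans le (⋖⇒val-< r)))

-- Sums over all subsets, shadows and initial segments

∑ : (Subset n → ℕ) → ℕ
∑ {zero}  f = f []
∑ {suc n} f = ∑ (λ X → f (false ∷ X)) + ∑ (λ X → f (true ∷ X))

∑-cong : {f g : Subset n → ℕ} → (∀ X → f X ≡ g X) → ∑ f ≡ ∑ g
∑-cong {zero}  eq = eq []
∑-cong {suc n} eq = cong₂ _+_ (∑-cong λ X → eq (false ∷ X)) (∑-cong λ X → eq (true ∷ X))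

∑-mono-≤ : {f g : Subset n → ℕ} → (∀ X → f X ≤ g X) → ∑ f ≤ ∑ g
∑-mono-≤ {zero}  le = le []
∑-mono-≤ {suc n} le = +-mono-≤ (∑-mono-≤ λ X → le (false ∷ X)) (∑-mono-≤ λ X → le (true ∷ X))

∑-mono-< : {f g : Subset n → ℕ} → (∀ X → f X ≤ g X) → ∀ A → f A < g A → ∑ f < ∑ g
∑-mono-< le []          lt = lt
∑-mono-< le (false ∷ A) lt =
  +-mono-<-≤ (∑-mono-< (λ X → le (false ∷ X)) A lt) (∑-mono-≤ λ X → le (true ∷ X))
∑-mono-< le (true ∷ A) lt =
  +-mono-≤-< (∑-mono-≤ λ X → le (false ∷ X)) (∑-mono-< (λ X → le (true ∷ X)) A lt)

∑-+ : (f g : Subset n → ℕ) → ∑ (λ X → f X + g X) ≡ ∑ f + ∑ g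
∑-+ {zero}  f g = refl
∑-+ {suc n} f g = trans
  (cong₂ _+_ (∑-+ (λ X → f (false ∷ X)) (λ X → g (false ∷ X))) (∑-+ (λ X → f (true ∷ X)) (λ X → g (true ∷ X))))
  (interchange +-commutativeSemigroup (∑ λ X → f (false ∷ X)) (∑ λ X → g (false ∷ X))
                                      (∑ λ X → f (true ∷ X)) (∑ λ X → g (true ∷ X)))

∑-* : (f : Subset n → ℕ) (c : ℕ) → ∑ (λ X → f X * c) ≡ ∑ f * c
∑-* {zero}  f c = refl
∑-* {suc n} f c = trans (cong₂ _+_ (∑-* (λ X → f (false ∷ X)) c) (∑-* (λ X → f (true ∷ X)) c))
                        (sym (*-distribʳ-+ c (∑ λ X → f (false ∷ X)) (∑ λ X → f (true ∷ X))))

∑-zero : ∀ n → ∑ {n} (λ _ → 0) ≡ 0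
∑-zero zero    = refl
∑-zero (suc n) = cong₂ _+_ (∑-zero n) (∑-zero n)

∑-insertAt : (f : Subset (suc n) → ℕ) (i : Fin (suc n)) →
             ∑ f ≡ ∑ (λ X → f (insertAt X i false)) + ∑ (λ X → f (insertAt X i true))
∑-insertAt         f zero    = refl
∑-insertAt {suc n} f (suc i) = trans
  (cong₂ _+_ (∑-insertAt (λ X → f (false ∷ X)) i) (∑-insertAt (λ X → f (true ∷ X)) i))
  (interchange +-commutativeSemigroup
    (∑ λ X → f (false ∷ insertAt X i false)) (∑ λ X → f (false ∷ insertAt X i true))
    (∑ λ X → f (true ∷ insertAt X i false)) (∑ λ X → f (true ∷ insertAt X i true)))

_≟ˢ_ : (X Y : Subset n) → Dec (X ≡ Y)
_≟ˢ_ = ≡-dec Bool._≟_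

∑-singleton : (A : Subset n) → ∑ (λ X → bit (does (X ≟ˢ A))) ≡ 1
∑-singleton []          = refl
∑-singleton {suc n} (false ∷ A) = cong₂ _+_ (∑-singleton A) (∑-zero n)
∑-singleton {suc n} (true  ∷ A) = cong₂ _+_ (∑-zero n) (∑-singleton A)

card : Family n → ℕ
card F = ∑ (λ X → bit (F X))

card-mono : {F G : Family n} → (∀ X → F X ≡ true → G X ≡ true) → card F ≤ card G
card-mono {F = F} {G} F⊆G = ∑-mono-≤ pointwise
  where
  pointwise : ∀ X → bit (F X) ≤ bit (G X)
  pointwise X with F X | F⊆G X
  ... | false | _ = z≤n
  ... | true  | p rewrite p refl = ≤-refl

-- The recursion follows the constructors of `_⋖_`, so that splitting along the head coordinate
-- holds by computation.
shadow : Family n → Family n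
shadow F []          = false
shadow F (false ∷ C) = F (true ∷ C) ∨ shadow (λ X → F (false ∷ X)) C
shadow F (true  ∷ C) = shadow (λ X → F (true ∷ X)) C

shadow⁺ : (F : Family n) {C X : Subset n} → C ⋖ X → F X ≡ true → shadow F C ≡ true
shadow⁺ F here FX rewrite FX = refl
shadow⁺ F (there {b = true} r) FX = shadow⁺ _ r FX
shadow⁺ F (there {b = false} {C} r) FX
  rewrite shadow⁺ (λ X → F (false ∷ X)) r FX = Bool.∨-zeroʳ (F (true ∷ C))

shadow⁻ : (F : Family n) (C : Subset n) → shadow F C ≡ true → ∃ λ X → C ⋖ X × F X ≡ true
shadow⁻ F (true ∷ C) eq with shadow⁻ _ C eq
... | X , r , FX = true ∷ X , there r , FX
shadow⁻ F (false ∷ C) eq with F (true ∷ C) in FC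
... | true = true ∷ C , here , FC
... | false with shadow⁻ _ C eq
... | X , r , FX = false ∷ X , there r , FX

shadow-cong : {F G : Family n} → (∀ X → F X ≡ G X) → ∀ C → shadow F C ≡ shadow G C
shadow-cong eq []          = refl
shadow-cong eq (false ∷ C) = cong₂ _∨_ (eq (true ∷ C)) (shadow-cong (λ X → eq (false ∷ X)) C)
shadow-cong eq (true  ∷ C) = shadow-cong (λ X → eq (true ∷ X)) C

∨-exchange : ∀ a b c → a ∨ (b ∨ c) ≡ b ∨ (a ∨ c)
∨-exchange false b     c = refl
∨-exchange true  false c = refl
∨-exchange true  true  c = refl

-- A cover of a set without `i` adds either `i` itself, which leads to the other section, or another
-- element, which stays in the same section.
shadow-insertAt-false : (F : Family (suc n)) (C : Subset n) (i : Fin (suc n)) →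
  shadow F (insertAt C i false) ≡ F (insertAt C i true) ∨ shadow (λ X → F (insertAt X i false)) C
shadow-insertAt-false F C           zero    = refl
shadow-insertAt-false F (true ∷ C)  (suc i) = shadow-insertAt-false (λ X → F (true ∷ X)) C i
shadow-insertAt-false F (false ∷ C) (suc i) = trans
  (cong (F (true ∷ insertAt C i false) ∨_) (shadow-insertAt-false (λ X → F (false ∷ X)) C i))
  (∨-exchange (F (true ∷ insertAt C i false)) (F (false ∷ insertAt C i true)) _)

shadow-insertAt-true : (F : Family (suc n)) (C : Subset n) (i : Fin (suc n)) →
  shadow F (insertAt C i true) ≡ shadow (λ X → F (insertAt X i true)) C
shadow-insertAt-true F C           zero    = refl
shadow-insertAt-true F (true ∷ C)  (suc i) = shadow-insertAt-true (λ X → F (true ∷ X)) C i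
shadow-insertAt-true F (false ∷ C) (suc i) =
  cong (F (true ∷ insertAt C i true) ∨_) (shadow-insertAt-true (λ X → F (false ∷ X)) C i)

card-shadow-insertAt : (F : Family (suc n)) (i : Fin (suc n)) →
  card (shadow F) ≡ card (λ X → F (insertAt X i true) ∨ shadow (λ Y → F (insertAt Y i false)) X)
                    + card (shadow (λ Y → F (insertAt Y i true)))
card-shadow-insertAt F i = trans (∑-insertAt (λ X → bit (shadow F X)) i)
  (cong₂ _+_ (∑-cong λ X → cong bit (shadow-insertAt-false F X i))
             (∑-cong λ X → cong bit (shadow-insertAt-true F X i)))

Initial : Family n → Set
Initial F = ∀ X Y → key Y < key X → F X ≡ true → F Y ≡ true

initial-≤ : {F : Family n} → Initial F → ∀ X Y → key Y ≤ key X → F X ≡ true → F Y ≡ true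
initial-≤ init X Y le FX with m≤n⇒m<n∨m≡n le
... | inj₁ lt = init X Y lt FX
... | inj₂ eq with key-injective Y X eq
... | refl = FX

-- If `D` is on a lower level than `C`, every cover of `D` is on a lower level than `X`. On the same
-- level, the colex-least cover of `D` does not come after `X`.
shadow-initial : {F : Family n} → Initial F → Initial (shadow F)
shadow-initial {n} {F} init C D lt sC with shadow⁻ F C sC
... | X , r , FX with key-<⁻ D C lt
... | inj₁ ∣D∣<∣C∣ with ∃⋗ D (<-≤-trans ∣D∣<∣C∣ (∣p∣≤n C))
... | Y , s = shadow⁺ F s (init X Y (∣∣-<⇒key-< Y X
                (subst₂ _<_ (sym (⋖⇒∣∣ s)) (sym (⋖⇒∣∣ r)) (s≤s ∣D∣<∣C∣))) FX)
shadow-initial {n} {F} init C D lt sC | X , r , FX | inj₂ (∣D∣≡∣C∣ , vlt) with val-<⇒∃⋗-≤ D C X ∣D∣≡∣C∣ vlt r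
... | Y , s , le = shadow⁺ F s (initial-≤ init X Y
        (+-mono-≤ (*-monoˡ-≤ (2 ^ n) (≤-reflexive (trans (⋖⇒∣∣ s) (trans (cong suc ∣D∣≡∣C∣) (sym (⋖⇒∣∣ r)))))) le) FX)

-- A member of `P` outside `Q` comes after all of `Q`, so the closure of `P` gives all of `Q`.
initial-nested : {P Q : Family n} → Initial P → Initial Q →
                 (∀ X → P X ≡ true → Q X ≡ true) ⊎ (∀ X → Q X ≡ true → P X ≡ true)
initial-nested {P = P} {Q} iP iQ with anySubset? (λ X → (P X Bool.≟ true) ×-dec (Q X Bool.≟ false))
... | no none = inj₁ λ X PX → Bool.¬-not λ QX → none (X , PX , QX)
... | yes (X , PX , QX) = inj₂ λ Y QY → initial-≤ iP X Y
        (≮⇒≥ λ X<Y → Bool.not-¬ QX (iQ Y X X<Y QY)) PX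

-- By nestedness the union is one of the two families. For arbitrary families only `card-∨-≥` holds,
-- and this gap is the gain of a compression.
card-∨-initial : {P Q : Family n} → Initial P → Initial Q → card (λ X → P X ∨ Q X) ≤ card P ⊔ card Q
card-∨-initial {P = P} {Q} iP iQ with initial-nested iP iQ
... | inj₁ P⊆Q = ≤-trans (card-mono (λ X → absorb (P X) (Q X) (P⊆Q X))) (m≤n⊔m (card P) (card Q))
  where
  absorb : ∀ a b → (a ≡ true → b ≡ true) → a ∨ b ≡ true → b ≡ true
  absorb false b _ e = e
  absorb true  b h _ = h refl
... | inj₂ Q⊆P = ≤-trans (card-mono (λ X → absorb (P X) (Q X) (Q⊆P X))) (m≤m⊔n (card P) (card Q))
  where
  absorb : ∀ a b → (b ≡ true → a ≡ true) → a ∨ b ≡ true → a ≡ true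
  absorb true  b _ _ = refl
  absorb false b h e = h e

card-∨-≥ : (P Q : Family n) → card P ⊔ card Q ≤ card (λ X → P X ∨ Q X)
card-∨-≥ P Q = ⊔-lub (card-mono λ X PX → subst (λ p → p ∨ Q X ≡ true) (sym PX) refl)
                     (card-mono λ X QX → trans (cong (P X ∨_) QX) (Bool.∨-zeroʳ (P X)))

-- Weights of families

sup : (Subset n → ℕ) → ℕ
sup {zero}  f = f []
sup {suc n} f = sup (λ X → f (false ∷ X)) ⊔ sup (λ X → f (true ∷ X))

sup-upper : (f : Subset n → ℕ) → ∀ X → f X ≤ sup f
sup-upper f []          = ≤-refl
sup-upper f (false ∷ X) = ≤-trans (sup-upper (λ X → f (false ∷ X)) X) (m≤m⊔n _ _)
sup-upper f (true  ∷ X) = ≤-trans (sup-upper (λ X → f (true ∷ X)) X) (m≤n⊔m (sup λ X → f (false ∷ X)) _)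

sup-least : (f : Subset n → ℕ) (b : ℕ) → (∀ X → f X ≤ b) → sup f ≤ b
sup-least {zero}  f b le = le []
sup-least {suc n} f b le = ⊔-lub (sup-least _ b λ X → le (false ∷ X)) (sup-least _ b λ X → le (true ∷ X))

weight : (Subset n → ℕ) → Family n → ℕ
weight ψ F = ∑ (λ X → bit (F X) * ψ X)

-- Some c satisfies C = {X : ψ X < c}.  As card C = card G, the weights may be compared with ψ - c
-- in place of ψ, where the comparison holds term by term; left and right avoid the subtraction.
module Threshold {n} (ψ : Subset n → ℕ) (C G : Family n) (card≡ : card C ≡ card G)
                 (separated : ∀ X Y → C X ≡ true → C Y ≡ false → ψ X < ψ Y) where

  -- `suc` makes the bound strict on `C`; sets outside `C` contribute 0, so an empty `C` gives
  -- threshold 0.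
  c : ℕ
  c = sup (λ X → bit (C X) * suc (ψ X))

  below : ∀ X → C X ≡ true → ψ X < c
  below X CX = ≤-trans (≤-reflexive (sym (trans (cong (λ a → bit a * suc (ψ X)) CX) (*-identityˡ (suc (ψ X))))))
                       (sup-upper (λ X → bit (C X) * suc (ψ X)) X)

  above : ∀ Y → C Y ≡ false → c ≤ ψ Y
  above Y CY = sup-least _ (ψ Y) bound
    where
    bound : ∀ X → bit (C X) * suc (ψ X) ≤ ψ Y
    bound X with C X in CX
    ... | false = z≤n
    ... | true  = ≤-trans (≤-reflexive (*-identityˡ (suc (ψ X)))) (separated X Y CX CY)

  left right : Subset n → ℕ
  left  X = bit (C X) * ψ X + bit (G X) * c
  right X = bit (G X) * ψ X + bit (C X) * c

  -- The two sides differ only where `C` and `G` do, and there they compare `ψ X` with `c`.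
  left≤right : ∀ X → left X ≤ right X
  left≤right X with C X in CX | G X
  ... | false | false = ≤-refl
  ... | true  | true  = ≤-refl
  ... | true  | false rewrite +-identityʳ (ψ X + 0) = +-monoˡ-≤ 0 (<⇒≤ (below X CX))
  ... | false | true  rewrite +-identityʳ (ψ X + 0) = +-monoˡ-≤ 0 (above X CX)

  ∑left : ∑ left ≡ weight ψ C + card C * c
  ∑left = trans (∑-+ (λ X → bit (C X) * ψ X) (λ X → bit (G X) * c))
         (cong (weight ψ C +_) (trans (∑-* (λ X → bit (G X)) c) (cong (_* c) (sym card≡))))

  ∑right : ∑ right ≡ weight ψ G + card C * c
  ∑right = trans (∑-+ (λ X → bit (G X) * ψ X) (λ X → bit (C X) * c))
                 (cong (weight ψ G +_) (∑-* (λ X → bit (C X)) c))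

  weight-≤ : weight ψ C ≤ weight ψ G
  weight-≤ = +-cancelʳ-≤ (card C * c) _ _ (subst₂ _≤_ ∑left ∑right (∑-mono-≤ left≤right))

  weight-<-at : ∀ A → left A < right A → weight ψ C < weight ψ G
  weight-<-at A lt = +-cancelʳ-< (card C * c) _ _ (subst₂ _<_ ∑left ∑right (∑-mono-< left≤right A lt))

  -- `C` cannot contain `B` without `A`. If `A` is in `C`, the term at `A` is strict because
  -- `ψ A < c`; otherwise the term at `B` is strict because `c ≤ ψ A < ψ B`.
  weight-< : ∀ A B → ψ A < ψ B → G A ≡ false → G B ≡ true → weight ψ C < weight ψ G
  weight-< A B A<B GA GB with C A in CA | C B in CB
  ... | true | _ = weight-<-at A strict
    where
    strict : left A < right A
    strict rewrite CA | GA | +-identityʳ (ψ A + 0) = +-monoˡ-< 0 (below A CA)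
  ... | false | false = weight-<-at B strict
    where
    strict : left B < right B
    strict rewrite CB | GB | +-identityʳ (ψ B + 0) = +-monoˡ-< 0 (≤-<-trans (above A CA) A<B)
  ... | false | true = contradiction A<B (<-asym (separated B A CB CA))

-- Compression along a coordinate

Dominated : Family n → Set
Dominated {n} F = ∃ λ (I : Family n) → Initial I × card I ≡ card F × card (shadow I) ≤ card (shadow F)

module Compression {n} (F : Family (suc n)) (i : Fin (suc n))
                   (sections : ∀ b → Dominated (λ X → F (insertAt X i b))) where

  section : Bool → Family n
  section b X = F (insertAt X i b)

  C : Bool → Family n
  C b = proj₁ (sections b)

  C-initial : ∀ b → Initial (C b)
  C-initial b = proj₁ (proj₂ (sections b))

  C-card : ∀ b → card (C b) ≡ card (section b)
  C-card b = proj₁ (proj₂ (proj₂ (sections b)))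

  C-shadow : ∀ b → card (shadow (C b)) ≤ card (shadow (section b))
  C-shadow b = proj₂ (proj₂ (proj₂ (sections b)))

  compressed : Family (suc n)
  compressed X = C (lookup X i) (removeAt X i)

  compressed-insertAt : ∀ b X → compressed (insertAt X i b) ≡ C b X
  compressed-insertAt b X = cong₂ C (insertAt-lookup X i b) (removeAt-insertAt X i b)

  card-compressed : card compressed ≡ card F
  card-compressed = begin
    card compressed
      ≡⟨ ∑-insertAt (λ X → bit (compressed X)) i ⟩
    card (λ X → compressed (insertAt X i false)) + card (λ X → compressed (insertAt X i true))
      ≡⟨ cong₂ _+_ (∑-cong λ X → cong bit (compressed-insertAt false X))
                   (∑-cong λ X → cong bit (compressed-insertAt true X)) ⟩
    card (C false) + card (C true)
      ≡⟨ cong₂ _+_ (C-card false) (C-card true) ⟩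
    card (section false) + card (section true)
      ≡⟨ ∑-insertAt (λ X → bit (F X)) i ⟨
    card F ∎
    where open ≡-Reasoning

  -- The part of the shadow without `i` is a union of two families. After compression both are
  -- initial, so the union has the size of the larger one; before, it is at least that large.
  card-shadow-compressed : card (shadow compressed) ≤ card (shadow F)
  card-shadow-compressed = begin
    card (shadow compressed)
      ≡⟨ card-shadow-insertAt compressed i ⟩
    _
      ≡⟨ cong₂ _+_ (∑-cong λ X → cong bit (cong₂ _∨_ (compressed-insertAt true X)
                                                   (shadow-cong (compressed-insertAt false) X)))
                   (∑-cong λ X → cong bit (shadow-cong (compressed-insertAt true) X)) ⟩
    card (λ X → C true X ∨ shadow (C false) X) + card (shadow (C true))
      ≤⟨ +-mono-≤ (card-∨-initial (C-initial true) (shadow-initial (C-initial false))) (C-shadow true) ⟩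
    card (C true) ⊔ card (shadow (C false)) + card (shadow (section true))
      ≤⟨ +-monoˡ-≤ _ (⊔-mono-≤ (≤-reflexive (C-card true)) (C-shadow false)) ⟩
    card (section true) ⊔ card (shadow (section false)) + card (shadow (section true))
      ≤⟨ +-monoˡ-≤ _ (card-∨-≥ (section true) (shadow (section false))) ⟩
    _
      ≡⟨ card-shadow-insertAt F i ⟨
    card (shadow F) ∎
    where open ≤-Reasoning

  module _ (b : Bool) where
    -- Sections are weighed by the keys of the full sets, so that the weights of the two sections
    -- add up to that of the family.
    open Threshold (λ X → key (insertAt X i b)) (C b) (section b) (C-card b)
      (λ X Y CX CY → key-insertAt-< X Y i b (≰⇒> λ Y≤X → Bool.not-¬ CY (initial-≤ (C-initial b) X Y Y≤X CX)))
      public using (weight-≤; weight-<)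

  weight-compressed : weight key compressed ≡
    weight (λ X → key (insertAt X i false)) (C false) + weight (λ X → key (insertAt X i true)) (C true)
  weight-compressed = trans (∑-insertAt (λ X → bit (compressed X) * key X) i)
    (cong₂ _+_ (∑-cong λ X → cong (λ a → bit a * key (insertAt X i false)) (compressed-insertAt false X))
               (∑-cong λ X → cong (λ a → bit a * key (insertAt X i true)) (compressed-insertAt true X)))

  -- The section containing the inversion loses weight and the other gains none. This decrease makes
  -- repeated compression terminate.
  weight-compressed-< : ∀ b A B → key (insertAt A i b) < key (insertAt B i b) →
    section b A ≡ false → section b B ≡ true → weight key compressed < weight key F
  weight-compressed-< b A B A<B FA FB =
    subst₂ _<_ (sym weight-compressed) (sym (∑-insertAt (λ X → bit (F X) * key X) i)) (strict b A<B FA FB)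
    where
    strict : ∀ b → key (insertAt A i b) < key (insertAt B i b) → section b A ≡ false → section b B ≡ true →
      weight (λ X → key (insertAt X i false)) (C false) + weight (λ X → key (insertAt X i true)) (C true) <
      weight (λ X → key (insertAt X i false)) (section false) + weight (λ X → key (insertAt X i true)) (section true)
    strict false lt FA FB = +-mono-<-≤ (weight-< false A B lt FA FB) (weight-≤ true)
    strict true  lt FA FB = +-mono-≤-< (weight-≤ false) (weight-< true A B lt FA FB)

-- Families whose inversions are complementary pairs

≢⇒∁ : (A B : Subset n) → (∀ i → lookup A i ≢ lookup B i) → A ≡ ∁ B
≢⇒∁ []      []      ne = refl
≢⇒∁ (a ∷ A) (b ∷ B) ne = cong₂ _∷_ (Bool.¬-not (ne zero)) (≢⇒∁ A B (λ i → ne (suc i)))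

∁-involutive : (X : Subset n) → ∁ (∁ X) ≡ X
∁-involutive []      = refl
∁-involutive (x ∷ X) = cong₂ _∷_ (Bool.not-involutive x) (∁-involutive X)

⋖-∁ : {C X : Subset n} → C ⋖ X → ∁ X ⋖ ∁ C
⋖-∁ here      = here
⋖-∁ (there r) = there (⋖-∁ r)

-- The largest element belongs to B, and B₋ omits another one.
∃⋖-∁ : (B : Subset n) → 2 ≤ ∣ B ∣ → val (∁ B) < val B → ∃ λ B₋ → B₋ ⋖ B × val (∁ B₋) < val B
∃⋖-∁ (true ∷ B) le lt with val-∷-<⁻ false true (∁ B) B lt
... | inj₁ p = false ∷ B , here , digit-< true true p
∃⋖-∁ (true ∷ false ∷ B) le lt | inj₂ (() , _)
∃⋖-∁ (true ∷ true ∷ B)  le lt | inj₂ (() , _)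
∃⋖-∁ (true ∷ [])  (s≤s ()) lt | inj₂ _
∃⋖-∁ (false ∷ B) le lt with val-∷-<⁻ true false (∁ B) B lt
... | inj₂ (_ , () , _)
... | inj₁ p with ∃⋖-∁ B le p
... | B₋ , r , q = false ∷ B₋ , there r , digit-< true false q

module Exchange {n} (F : Family n) (A B : Subset n) (A<B : key A < key B) (FA : F A ≡ false) (FB : F B ≡ true)
                (inversion⇒∁ : ∀ X Y → key X < key Y → F X ≡ false → F Y ≡ true → X ≡ ∁ Y) where

  A≡∁B : A ≡ ∁ B
  A≡∁B = inversion⇒∁ A B A<B FA FB

  -- A gap before `B` would form an inversion with `B`, hence equal `∁ B`, which is `A`.
  below-B : ∀ Z → key Z < key B → Z ≢ A → F Z ≡ true
  below-B Z Z<B Z≢A = Bool.¬-not λ FZ → Z≢A (trans (inversion⇒∁ Z B Z<B FZ FB) (sym A≡∁B))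

  -- Dual to `below-B`. Together they leave no set strictly between `A` and `B`.
  above-A : ∀ Z → key A < key Z → Z ≢ B → F Z ≡ false
  above-A Z A<Z Z≢B = Bool.¬-not λ FZ → Z≢B
    (trans (sym (∁-involutive Z))
    (trans (cong ∁ (trans (sym (inversion⇒∁ A Z A<Z FA FZ)) A≡∁B)) (∁-involutive B)))

  exchanged : Family n
  exchanged X = does (X ≟ˢ A) ∨ (F X ∧ not (does (X ≟ˢ B)))

  exchanged-A : exchanged A ≡ true
  exchanged-A with A ≟ˢ A
  ... | yes _ = refl
  ... | no ne = contradiction refl ne

  exchanged⁺ : ∀ X → F X ≡ true → X ≢ B → exchanged X ≡ true
  exchanged⁺ X FX X≢B with X ≟ˢ A | X ≟ˢ B
  ... | yes _ | _     = refl
  ... | no _  | yes e = contradiction e X≢B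
  ... | no _  | no _  rewrite FX = refl

  exchanged⁻ : ∀ X → exchanged X ≡ true → X ≡ A ⊎ (F X ≡ true × X ≢ B)
  exchanged⁻ X eq with X ≟ˢ A | X ≟ˢ B | F X
  ... | yes e | _     | _    = inj₁ e
  ... | no _  | no ne | true = inj₂ (refl , ne)

  F-≢A : ∀ {X} → F X ≡ true → X ≢ A
  F-≢A FX refl = Bool.not-¬ FA FX

  exchanged-initial : Initial exchanged
  exchanged-initial X Y Y<X eX with exchanged⁻ X eX
  ... | inj₁ refl = exchanged⁺ Y (below-B Y (<-trans Y<X A<B) λ { refl → <-irrefl refl Y<X })
                                 λ { refl → <-asym Y<X A<B }
  ... | inj₂ (FX , X≢B) with toSum (Y ≟ˢ A)
  ... | inj₁ refl = exchanged-A
  -- A member `X` of `F` other than `B` must precede `A`.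
  ... | inj₂ Y≢A with <-cmp (key A) (key X)
  ... | tri< A<X _ _ = contradiction FX (Bool.not-¬ (above-A X A<X X≢B))
  ... | tri≈ _ e _   = contradiction (sym (key-injective A X e)) (F-≢A FX)
  ... | tri> _ _ X<A = exchanged⁺ Y (below-B Y Y<B Y≢A) λ { refl → <-irrefl refl Y<B }
    where
    Y<B : key Y < key B
    Y<B = <-trans Y<X (<-trans X<A A<B)

  -- The indicators of `B` and `A` are added to the two sides in order to avoid a subtraction.
  card-exchanged : card exchanged ≡ card F
  card-exchanged = +-cancelʳ-≡ 1 _ _ (begin
    card exchanged + 1
      ≡⟨ cong (card exchanged +_) (∑-singleton B) ⟨
    card exchanged + ∑ (λ X → bit (does (X ≟ˢ B)))
      ≡⟨ ∑-+ (λ X → bit (exchanged X)) (λ X → bit (does (X ≟ˢ B))) ⟨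
    ∑ (λ X → bit (exchanged X) + bit (does (X ≟ˢ B)))
      ≡⟨ ∑-cong pointwise ⟩
    ∑ (λ X → bit (F X) + bit (does (X ≟ˢ A)))
      ≡⟨ ∑-+ (λ X → bit (F X)) (λ X → bit (does (X ≟ˢ A))) ⟩
    card F + ∑ (λ X → bit (does (X ≟ˢ A)))
      ≡⟨ cong (card F +_) (∑-singleton A) ⟩
    card F + 1 ∎)
    where
    open ≡-Reasoning
    pointwise : ∀ X → bit (exchanged X) + bit (does (X ≟ˢ B)) ≡ bit (F X) + bit (does (X ≟ˢ A))
    pointwise X with X ≟ˢ A | X ≟ˢ B
    ... | yes refl | yes refl = contradiction A<B (<-irrefl refl)
    ... | yes refl | no _     rewrite FA = refl
    ... | no _     | yes refl rewrite FB = refl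
    ... | no _     | no _     with F X
    ...   | true  = refl
    ...   | false = refl

  -- This makes `A` add nothing to the shadow. For `B₋ ⋖ B` one has `C ⋖ A ⋖ ∁ B₋`, and the diamond
  -- yields a second cover `Z` of `C`, which is in `F` once it precedes `B`.
  ∃⋗-in-F : ∀ C → C ⋖ A → ∃ λ Z → C ⋖ Z × F Z ≡ true
  ∃⋗-in-F C C⋖A with key-<⁻ A B A<B
  -- Any `B₋` serves here, since `Z` has the cardinality of `A`.
  ... | inj₁ ∣A∣<∣B∣ with ∃⋖ B (≤-<-trans z≤n ∣A∣<∣B∣)
  ... | B₋ , r with ⋖-diamond C⋖A (subst (_⋖ ∁ B₋) (sym A≡∁B) (⋖-∁ r))
  ... | Z , s , _ , Z≢A = Z , s , below-B Z (∣∣-<⇒key-< Z B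
          (subst (_< ∣ B ∣) (trans (⋖⇒∣∣ C⋖A) (sym (⋖⇒∣∣ s))) ∣A∣<∣B∣)) Z≢A
  ∃⋗-in-F C C⋖A | inj₂ (∣A∣≡∣B∣ , vlt) with 2 ≤? ∣ B ∣
  -- On equal levels `B₋` has to satisfy `val (∁ B₋) < val B`, which bounds `val Z`.
  ... | yes 2≤∣B∣ with ∃⋖-∁ B 2≤∣B∣ (subst (λ X → val X < val B) A≡∁B vlt)
  ... | B₋ , r , lt with ⋖-diamond C⋖A (subst (_⋖ ∁ B₋) (sym A≡∁B) (⋖-∁ r))
  ... | Z , s , t , Z≢A = Z , s , below-B Z (val-<⇒key-< Z B
          (≤-reflexive (trans (⋖⇒∣∣ s) (trans (sym (⋖⇒∣∣ C⋖A)) ∣A∣≡∣B∣)))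
          (<-trans (⋖⇒val-< t) lt)) Z≢A
  -- `A` and `B` are singletons, so `C` is empty and `B` itself covers it.
  ∃⋗-in-F C C⋖A | inj₂ (∣A∣≡∣B∣ , vlt) | no 2≰∣B∣
    with ∃⋖ B (subst (0 <_) (trans (sym (⋖⇒∣∣ C⋖A)) ∣A∣≡∣B∣) (s≤s z≤n))
  ... | B₋ , r = B , subst (_⋖ B) B₋≡C r , FB
    where
    ∣C∣≡∣B₋∣ : ∣ C ∣ ≡ ∣ B₋ ∣
    ∣C∣≡∣B₋∣ = suc-injective (trans (sym (⋖⇒∣∣ C⋖A)) (trans ∣A∣≡∣B∣ (⋖⇒∣∣ r)))
    ∣B₋∣≡0 : ∣ B₋ ∣ ≡ 0
    ∣B₋∣≡0 = n<1⇒n≡0 (≤-pred (subst (_< 2) (⋖⇒∣∣ r) (≰⇒> 2≰∣B∣)))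
    B₋≡C : B₋ ≡ C
    B₋≡C = ∣∣≡0-unique B₋ C ∣B₋∣≡0 (trans ∣C∣≡∣B₋∣ ∣B₋∣≡0)

  shadow-exchanged⊆ : ∀ C → shadow exchanged C ≡ true → shadow F C ≡ true
  shadow-exchanged⊆ C sC with shadow⁻ exchanged C sC
  ... | X , r , eX with exchanged⁻ X eX
  ... | inj₂ (FX , _) = shadow⁺ F r FX
  ... | inj₁ refl with ∃⋗-in-F C r
  ... | Z , s , FZ = shadow⁺ F s FZ

  dominated : Dominated F
  dominated = exchanged , exchanged-initial , card-exchanged , card-mono shadow-exchanged⊆

-- Induction on the dimension and on the weight

inversion? : (F : Family n) → Dec (∃ λ A → ∃ λ B → key A < key B × F A ≡ false × F B ≡ true)
inversion? F = anySubset? λ A → anySubset? λ B →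
  (key A <? key B) ×-dec (F A Bool.≟ false) ×-dec (F B Bool.≟ true)

agreeing-inversion? : (F : Family n) →
  Dec (∃ λ A → ∃ λ B → ∃ λ i → key A < key B × F A ≡ false × F B ≡ true × lookup A i ≡ lookup B i)
agreeing-inversion? F = anySubset? λ A → anySubset? λ B → any? λ i →
  (key A <? key B) ×-dec (F A Bool.≟ false) ×-dec (F B Bool.≟ true) ×-dec (lookup A i Bool.≟ lookup B i)

-- The outer recursion on `n` supplies the sections for a compression. The inner one is on a strict
-- bound `k` for the weight, which turns the decrease into structural recursion.
all-dominated : ∀ n (F : Family n) → Dominated F
bounded-dominated : ∀ n (k : ℕ) (F : Family (suc n)) → weight key F < k → Dominated F

all-dominated zero    F = F , (λ { [] [] () }) , refl , ≤-refl
all-dominated (suc n) F = bounded-dominated n (suc (weight key F)) F ≤-refl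

bounded-dominated n (suc k) F (s≤s w≤k) with agreeing-inversion? F
... | yes (A , B , i , A<B , FA , FB , agree) =
  let I , init , card≡ , shadow≤ = bounded-dominated n k compressed (<-≤-trans decrease w≤k)
  in  I , init , trans card≡ card-compressed , ≤-trans shadow≤ card-shadow-compressed
  where
  open Compression F i (λ b → all-dominated n (λ X → F (insertAt X i b)))
  eqA : insertAt (removeAt A i) i (lookup A i) ≡ A
  eqA = insertAt-removeAt A i
  eqB : insertAt (removeAt B i) i (lookup A i) ≡ B
  eqB = trans (cong (insertAt (removeAt B i) i) agree) (insertAt-removeAt B i)
  decrease : weight key compressed < weight key F
  -- `A` and `B` lie in the same section, that of their common value at `i`.
  decrease = weight-compressed-< (lookup A i) (removeAt A i) (removeAt B i)
    (subst₂ (λ X Y → key X < key Y) (sym eqA) (sym eqB) A<B) (trans (cong F eqA) FA) (trans (cong F eqB) FB)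
... | no none with inversion? F
-- The two sets of any remaining inversion differ at every coordinate, hence are complementary.
... | yes (A , B , A<B , FA , FB) = Exchange.dominated F A B A<B FA FB
        λ X Y X<Y FX FY → ≢⇒∁ X Y λ i agree → none (X , Y , i , X<Y , FX , FY , agree)
... | no none′ = F , (λ X Y Y<X FX → Bool.¬-not λ FY → none′ (Y , X , Y<X , FY , FX)) , refl , ≤-refl

-- Comparison with the list-based definitions

countᵇ-++ : {A : Set} (p : A → Bool) (xs ys : List A) → countᵇ p (xs ++ ys) ≡ countᵇ p xs + countᵇ p ys
countᵇ-++ p []       ys = refl
countᵇ-++ p (x ∷ xs) ys with p x
... | true  = cong suc (countᵇ-++ p xs ys)
... | false = countᵇ-++ p xs ys

countᵇ-map : {A B : Set} (p : B → Bool) (f : A → B) (xs : List A) →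
             countᵇ p (map f xs) ≡ countᵇ (λ x → p (f x)) xs
countᵇ-map p f []       = refl
countᵇ-map p f (x ∷ xs) with p (f x)
... | true  = cong suc (countᵇ-map p f xs)
... | false = countᵇ-map p f xs

size≡card : (F : Family n) → size F ≡ card F
size≡card {zero} F with F []
... | true  = refl
... | false = refl
size≡card {suc n} F = trans (countᵇ-++ F (map (false ∷_) (allSubsets n)) (map (true ∷_) (allSubsets n)))
  (cong₂ _+_ (trans (countᵇ-map F (false ∷_) (allSubsets n)) (size≡card λ X → F (false ∷ X)))
             (trans (countᵇ-map F (true ∷_) (allSubsets n)) (size≡card λ X → F (true ∷ X))))

∈-allSubsets : (X : Subset n) → X ∈ allSubsets n
∈-allSubsets []                  = here refl
∈-allSubsets {suc n} (false ∷ X) = ∈-++⁺ˡ (∈-map⁺ (false ∷_) (∈-allSubsets X))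
∈-allSubsets {suc n} (true  ∷ X) = ∈-++⁺ʳ (map (false ∷_) (allSubsets n)) (∈-map⁺ (true ∷_) (∈-allSubsets X))

TopDiff : (A B : Subset n) → Maybe Bool → Set
TopDiff A B (just true)  = val A < val B
TopDiff A B (just false) = val B < val A
TopDiff A B nothing      = A ≡ B

topDiffInB-correct : (A B : Subset n) → TopDiff A B (topDiffInB A B)
topDiffInB-correct []      []      = refl
topDiffInB-correct (a ∷ A) (b ∷ B) with topDiffInB A B | topDiffInB-correct A B
... | just true  | lt = digit-< a b lt
... | just false | lt = digit-< b a lt
topDiffInB-correct (false ∷ A) (false ∷ A) | nothing | refl = refl
topDiffInB-correct (false ∷ A) (true  ∷ A) | nothing | refl = ≤-refl
topDiffInB-correct (true  ∷ A) (false ∷ A) | nothing | refl = ≤-refl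
topDiffInB-correct (true  ∷ A) (true  ∷ A) | nothing | refl = refl

<lc-reflects : (A B : Subset n) → Reflects (key A < key B) (A <lc B)
<lc-reflects A B with ∣ A ∣ <ᵇ ∣ B ∣ | <ᵇ-reflects-< ∣ A ∣ ∣ B ∣ | ∣ A ∣ ≡ᵇ ∣ B ∣ | proof (∣ A ∣ ≟ ∣ B ∣)
                    | topDiffInB A B | topDiffInB-correct A B
... | true  | ofʸ lt | _     | _      | _          | _    = ofʸ (∣∣-<⇒key-< A B lt)
... | false | _      | true  | ofʸ eq | just true  | lt   = ofʸ (val-<⇒key-< A B (≤-reflexive eq) lt)
... | false | _      | true  | ofʸ eq | just false | gt   = ofⁿ (<-asym (val-<⇒key-< B A (≤-reflexive (sym eq)) gt))
... | false | _      | true  | _      | nothing    | refl = ofⁿ (<-irrefl refl)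
... | false | ofⁿ ge | false | ofⁿ ne | _          | _    =
  ofⁿ λ lt → ne (≤-antisym (key-<⇒∣∣-≤ A B lt) (≮⇒≥ ge))

reflects-true : ∀ {P : Set} {b} → Reflects P b → P → b ≡ true
reflects-true (ofʸ _)  _ = refl
reflects-true (ofⁿ ¬p) p = contradiction p ¬p

reflects-false : ∀ {P : Set} {b} → Reflects P b → ¬ P → b ≡ false
reflects-false (ofʸ p) ¬p = contradiction p ¬p
reflects-false (ofⁿ _) _  = refl

<lc⇒key-< : (A B : Subset n) → (A <lc B) ≡ true → key A < key B
<lc⇒key-< A B eq = invert (subst (Reflects _) eq (<lc-reflects A B))

-- The rank of `X` counts its predecessors. If `X` is in `I`, they form a subfamily of `I` that
-- misses `X`; if not, they include all of `I`.
initial≡initialSegment : (I : Family n) → Initial I → ∀ X → initialSegment n (card I) X ≡ I X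
initial≡initialSegment {n} I init X with I X in IX
... | true  = reflects-true (<ᵇ-reflects-< _ _) (subst (_< card I) (sym (size≡card λ C → C <lc X))
                (∑-mono-< pointwise X (subst₂ (λ a b → bit a < bit b) (sym X≮X) (sym IX) (s≤s z≤n))))
  where
  X≮X : (X <lc X) ≡ false
  X≮X = reflects-false (<lc-reflects X X) (<-irrefl refl)
  pointwise : ∀ C → bit (C <lc X) ≤ bit (I C)
  pointwise C with C <lc X in C<X
  ... | false = z≤n
  ... | true  rewrite init X C (<lc⇒key-< C X C<X) IX = ≤-refl
... | false = reflects-false (<ᵇ-reflects-< _ _) (≤⇒≯ (subst (card I ≤_) (sym (size≡card λ C → C <lc X))
                (card-mono λ C IC → reflects-true (<lc-reflects C X)
                  (≰⇒> λ X≤C → Bool.not-¬ IX (initial-≤ init C X X≤C IC)))))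

-- Maximal elements and the shadow of a downset

⋖⇒⊂ : {C X : Subset n} → C ⋖ X → C ⊂ X
⋖⇒⊂ here      = out⊂in ⊆-refl
⋖⇒⊂ (there r) = s⊂s (⋖⇒⊂ r)

-- For a downset containing `Y`, the cover `X` is again a member, so being non-maximal reduces to
-- lying in the shadow.
⊂⇒∃⋗ : (C Y : Subset n) → C ⊂ Y → ∃ λ X → C ⋖ X × X ⊆ Y
⊂⇒∃⋗ (false ∷ C) (true ∷ Y) (C⊆Y , _) = true ∷ C , here , in⊆in (drop-∷-⊆ C⊆Y)
⊂⇒∃⋗ (true ∷ C) (false ∷ Y) (C⊆Y , _) = contradiction (C⊆Y here) λ ()
⊂⇒∃⋗ (false ∷ C) (false ∷ Y) C⊂Y with ⊂⇒∃⋗ C Y (drop-∷-⊂ C⊂Y)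
... | X , r , X⊆Y = false ∷ X , there r , s⊆s X⊆Y
⊂⇒∃⋗ (true ∷ C) (true ∷ Y) C⊂Y with ⊂⇒∃⋗ C Y (drop-∷-⊂ C⊂Y)
... | X , r , X⊆Y = true ∷ X , there r , s⊆s X⊆Y

⊆⇒val-≤ : (X Y : Subset n) → X ⊆ Y → val X ≤ val Y
⊆⇒val-≤ []          []          _   = z≤n
⊆⇒val-≤ (false ∷ X) (y ∷ Y)     X⊆Y =
  ≤-trans (*-monoʳ-≤ 2 (⊆⇒val-≤ X Y (drop-∷-⊆ X⊆Y))) (m≤n+m (2 * val Y) (bit y))
⊆⇒val-≤ (true ∷ X)  (true ∷ Y)  X⊆Y = s≤s (*-monoʳ-≤ 2 (⊆⇒val-≤ X Y (drop-∷-⊆ X⊆Y)))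
⊆⇒val-≤ (true ∷ X)  (false ∷ Y) X⊆Y = contradiction (X⊆Y here) λ ()

initial⇒downset : (I : Family n) → Initial I → IsDownset I
initial⇒downset {n} I init X Y Y⊆X IX = initial-≤ init X Y
  (+-mono-≤ (*-monoˡ-≤ (2 ^ n) (p⊆q⇒∣p∣≤∣q∣ Y⊆X)) (⊆⇒val-≤ Y X Y⊆X)) IX

T⇒≡ : ∀ {b} → T b → b ≡ true
T⇒≡ = Equivalence.to Bool.T-≡

≡⇒T : ∀ {b} → b ≡ true → T b
≡⇒T = Equivalence.from Bool.T-≡

module _ (D : Family n) (down : IsDownset D) where

  properlyContained : Subset n → Bool
  properlyContained X = any (λ Y → D Y ∧ does (X ⊂? Y)) (allSubsets n)

  shadow⇒contained : ∀ X → shadow D X ≡ true → properlyContained X ≡ true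
  shadow⇒contained X sX with shadow⁻ D X sX
  ... | Y , r , DY = T⇒≡ (any⁺ _ (lose (∈-allSubsets Y)
          (Equivalence.from Bool.T-∧ (≡⇒T DY , ≡⇒T (dec-true (X ⊂? Y) (⋖⇒⊂ r))))))

  contained⇒shadow : ∀ X → properlyContained X ≡ true → shadow D X ≡ true
  contained⇒shadow X cX with find (any⁻ (λ Y → D Y ∧ does (X ⊂? Y)) (allSubsets n) (≡⇒T cX))
  ... | Y , _ , t with Equivalence.to Bool.T-∧ t
  ... | DY , X⊂Y with ⊂⇒∃⋗ X Y (invert (subst (Reflects (X ⊂ Y)) (T⇒≡ X⊂Y) (proof (X ⊂? Y))))
  ... | Z , r , Z⊆Y = shadow⁺ D r (down Y Z Z⊆Y (T⇒≡ DY))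

  shadow⊆ : ∀ X → shadow D X ≡ true → D X ≡ true
  shadow⊆ X sX with shadow⁻ D X sX
  ... | Y , r , DY = down Y X (proj₁ (⋖⇒⊂ r)) DY

  -- The shadow of a downset lies inside it and consists of exactly its non-maximal members.
  m+shadow : m D + card (shadow D) ≡ card D
  m+shadow = trans (cong (_+ card (shadow D)) (size≡card (isMaximal D)))
    (trans (sym (∑-+ (λ X → bit (isMaximal D X)) (λ X → bit (shadow D X)))) (∑-cong pointwise))
    where
    bits : ∀ d c s → (s ≡ true → c ≡ true) → (c ≡ true → s ≡ true) → (s ≡ true → d ≡ true) →
           bit (d ∧ not c) + bit s ≡ bit d
    bits true  true  true  _ _ _ = refl
    bits true  false false _ _ _ = refl
    bits false _     false _ _ _ = refl
    bits true  true  false _ h _ = contradiction (h refl) λ ()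
    bits true  false true  h _ _ = contradiction (h refl) λ ()
    bits false _     true  _ _ h = contradiction (h refl) λ ()
    pointwise : ∀ X → bit (isMaximal D X) + bit (shadow D X) ≡ bit (D X)
    pointwise X = bits (D X) (properlyContained X) (shadow D X)
                       (shadow⇒contained X) (contained⇒shadow X) (shadow⊆ X)

theorem4 : (n : ℕ) (𝒜 : Family n) → IsDownset 𝒜 →
    m 𝒜 ≤ m (initialSegment n (size 𝒜))
theorem4 n 𝒜 down with all-dominated n 𝒜
-- Both downsets split into maximal members and shadow with the same total, so the smaller shadow
-- leaves more maximal members.
... | I , init , card≡ , shadow≤ = +-cancelʳ-≤ (card (shadow 𝒜)) _ _ (begin
  m 𝒜 + card (shadow 𝒜)  ≡⟨ m+shadow 𝒜 down ⟩
  card 𝒜                 ≡⟨ card≡ ⟨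
  card I                 ≡⟨ ∑-cong (λ X → cong bit (𝒥≡I X)) ⟨
  card 𝒥                 ≡⟨ m+shadow 𝒥 𝒥-down ⟨
  m 𝒥 + card (shadow 𝒥)  ≡⟨ cong (m 𝒥 +_) (∑-cong λ X → cong bit (shadow-cong 𝒥≡I X)) ⟩
  m 𝒥 + card (shadow I)  ≤⟨ +-monoʳ-≤ (m 𝒥) shadow≤ ⟩
  m 𝒥 + card (shadow 𝒜)  ∎)
  where
  open ≤-Reasoning
  𝒥 : Family n
  𝒥 = initialSegment n (size 𝒜)
  𝒥≡I : ∀ X → 𝒥 X ≡ I X
  𝒥≡I X = trans (cong (λ k → initialSegment n k X) (trans (size≡card 𝒜) (sym card≡)))
                (initial≡initialSegment I init X)
  𝒥-down : IsDownset 𝒥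
  𝒥-down X Y Y⊆X 𝒥X = trans (𝒥≡I Y) (initial⇒downset I init X Y Y⊆X (trans (sym (𝒥≡I X)) 𝒥X))
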